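{- Let $\Omega$ be a topological signature, let $A$ be a profinite $\Omega$-algebra, and let $\theta$ be a closed congruence on $A$ such that the quotient space $A/\theta$ is 0-dimensional. Then $\theta$ is a profinite congruence, i.e., the quotient topological algebra $A/\theta$ is profinite.
   Context: A signature is a disjoint union $\Omega=\biguplus_{n\in\mathbb{N}}\Omega_n$; it is topological if each $\Omega_n$ is a topological space. An $\Omega$-algebra is a set $A$ with evaluation maps $E_n^A:\Omega_n\times A^n\to A$; it is a topological $\Omega$-algebra if $A$ is a topological space and each $E_n^A$ is continuous. Compact spaces are required to be Hausdorff. A topological algebra is profinite if it is compact and residually finite, i.e. for any two distinct elements there is a continuous homomorphism into a finite discrete topological $\Omega$-algebra separating them. A congruence $\theta$ is closed if it is a closed subset of $A\times A$; the quotient $A/\theta$ carries the quotient topology and the induced operations. A congruence is called profinite if the quotient topological algebra $A/\theta$ is profinite. -}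

module Defs where

open import Data.Fin.Base using (Fin)
open import Data.List.Base using (List)
open import Data.List.Relation.Unary.Any using (Any)
open import Data.Nat.Base using (ℕ)
open import Data.Product.Base using (Σ-syntax; ∃-syntax; _×_; _,_; proj₁; proj₂; uncurry)
open import Data.Product.Relation.Binary.Pointwise.NonDependent using (_×ₛ_)
open import Data.Unit.Polymorphic.Base using (⊤; tt)
open import Data.Vec.Functional.Relation.Binary.Equality.Setoid using (≋-setoid)
open import Function.Base using (_∘_)
open import Function.Bundles using (Func; Bijection; _⟨$⟩_)
open import Level using (Level) renaming (suc to lsuc)
open import Relation.Binary.Bundles using (Setoid)
open import Relation.Binary.Core using (Rel; _⇒_)
open import Relation.Binary.Definitions using (_Respects_)
open import Relation.Binary.PropositionalEquality.Properties using () renaming (setoid to ≡-setoid)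
open import Relation.Binary.Structures using (IsEquivalence)
open import Relation.Nullary.Negation.Core using (¬_)
open import Relation.Unary using (Pred; _∈_; _⊆_; _≐_; _∩_; ∁; ⋃; Empty)

open Setoid using (Carrier)

private
  variable
    ℓ : Level

-- Sets are setoids, so that quotients exist; a subset of a setoid is a
-- predicate respecting its equality.  Openness of the empty set is the
-- case of an empty index type in Open-⋃.  Classically, subsets of X are
-- functions X → Bool, so families indexed by types in Set ℓ account for
-- all families of subsets; the same applies to open covers below.

record Topology (S : Setoid ℓ ℓ) : Set (lsuc (lsuc ℓ)) where
  open Setoid S using (_≈_) renaming (Carrier to X)
  field
    Open          : Pred (Pred X ℓ) (lsuc ℓ)
    Open-respects : ∀ {U} → Open U → U Respects _≈_
    Open-≐        : ∀ {U V} → U ≐ V → Open U → Open V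
    Open-full     : Open (λ _ → ⊤)
    Open-∩        : ∀ {U V} → Open U → Open V → Open (U ∩ V)
    Open-⋃        : ∀ {I : Set ℓ} {U : I → Pred X ℓ} →
                    (∀ i → Open (U i)) → Open (⋃ I U)

  Closed : Pred (Pred X ℓ) (lsuc ℓ)
  Closed U = Open (∁ U)

  Clopen : Pred (Pred X ℓ) (lsuc ℓ)
  Clopen U = Open U × Closed U

open Topology using (Open; Closed; Clopen)

module _ {S T : Setoid ℓ ℓ} where

  Continuous : Topology S → Topology T → Func S T → Set (lsuc ℓ)
  Continuous 𝒮 𝒯 f = ∀ V → Open 𝒯 V → Open 𝒮 (λ x → (f ⟨$⟩ x) ∈ V)

  infixr 5 _×ᵗ_

  _×ᵗ_ : Topology S → Topology T → Topology (S ×ₛ T)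
  _×ᵗ_ 𝒮 𝒯 = record
    { Open          = OpenBox
    ; Open-respects = λ { oW (x≈x′ , y≈y′) w →
        let (U , V , oU , oV , x∈U , y∈V , box) = oW _ _ w in
        box _ _ (S.Open-respects oU x≈x′ x∈U) (T.Open-respects oV y≈y′ y∈V) }
    ; Open-≐        = λ { (W⊆W′ , W′⊆W) oW x y w →
        let (U , V , oU , oV , x∈U , y∈V , box) = oW x y (W′⊆W w) in
        U , V , oU , oV , x∈U , y∈V , λ x′ y′ u v → W⊆W′ (box x′ y′ u v) }
    ; Open-full     = λ x y _ →
        (λ _ → ⊤) , (λ _ → ⊤) , S.Open-full , T.Open-full , tt , tt , λ _ _ _ _ → tt
    ; Open-∩        = λ { oW oW′ x y (w , w′) →
        let (U , V , oU , oV , x∈U , y∈V , box) = oW x y w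
            (U′ , V′ , oU′ , oV′ , x∈U′ , y∈V′ , box′) = oW′ x y w′ in
        U ∩ U′ , V ∩ V′ , S.Open-∩ oU oU′ , T.Open-∩ oV oV′ ,
        (x∈U , x∈U′) , (y∈V , y∈V′) ,
        λ x′ y′ u v → box x′ y′ (proj₁ u) (proj₁ v) , box′ x′ y′ (proj₂ u) (proj₂ v) }
    ; Open-⋃        = λ { oW x y (i , w) →
        let (U , V , oU , oV , x∈U , y∈V , box) = oW i x y w in
        U , V , oU , oV , x∈U , y∈V , λ x′ y′ u v → i , box x′ y′ u v }
    }
    where
    module S = Topology 𝒮
    module T = Topology 𝒯
    OpenBox : Pred (Pred (Carrier S × Carrier T) ℓ) (lsuc ℓ)
    OpenBox W = ∀ x y → (x , y) ∈ W →
      ∃[ U ] ∃[ V ] S.Open U × T.Open V × x ∈ U × y ∈ V ×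
        (∀ x′ y′ → x′ ∈ U → y′ ∈ V → (x′ , y′) ∈ W)

module _ {S : Setoid ℓ ℓ} where

  infixl 7 _^ᵗ_

  _^ᵗ_ : Topology S → (n : ℕ) → Topology (≋-setoid S n)
  𝒮 ^ᵗ n = record
    { Open          = OpenBox
    ; Open-respects = λ oW xs≋ys w →
        let (U , oU , xs∈U , box) = oW _ w in
        box _ (λ i → S.Open-respects (oU i) (xs≋ys i) (xs∈U i))
    ; Open-≐        = λ { (W⊆W′ , W′⊆W) oW xs w →
        let (U , oU , xs∈U , box) = oW xs (W′⊆W w) in
        U , oU , xs∈U , λ ys ys∈U → W⊆W′ (box ys ys∈U) }
    ; Open-full     = λ xs _ →
        (λ _ _ → ⊤) , (λ _ → S.Open-full) , (λ _ → tt) , λ _ _ → tt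
    ; Open-∩        = λ { oW oW′ xs (w , w′) →
        let (U , oU , xs∈U , box) = oW xs w
            (U′ , oU′ , xs∈U′ , box′) = oW′ xs w′ in
        (λ i → U i ∩ U′ i) , (λ i → S.Open-∩ (oU i) (oU′ i)) ,
        (λ i → xs∈U i , xs∈U′ i) ,
        λ ys ys∈ → box ys (proj₁ ∘ ys∈) , box′ ys (proj₂ ∘ ys∈) }
    ; Open-⋃        = λ { oW xs (i , w) →
        let (U , oU , xs∈U , box) = oW i xs w in
        U , oU , xs∈U , λ ys ys∈U → i , box ys ys∈U }
    }
    where
    module S = Topology 𝒮
    OpenBox : Pred (Pred (Fin n → Carrier S) ℓ) (lsuc ℓ)
    OpenBox W = ∀ xs → xs ∈ W →
      Σ[ U ∈ (Fin n → Pred (Carrier S) ℓ) ]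
        (∀ i → S.Open (U i)) × (∀ i → xs i ∈ U i) ×
        (∀ ys → (∀ i → ys i ∈ U i) → ys ∈ W)

  open Setoid S using (_≈_) renaming (Carrier to X)

  Hausdorff : Topology S → Set (lsuc ℓ)
  Hausdorff 𝒮 = ∀ x y → ¬ (x ≈ y) →
    ∃[ U ] ∃[ V ] Open 𝒮 U × Open 𝒮 V × x ∈ U × y ∈ V × Empty (U ∩ V)

  EveryOpenCoverHasFiniteSubcover : Topology S → Set (lsuc ℓ)
  EveryOpenCoverHasFiniteSubcover 𝒮 =
    (I : Set ℓ) (U : I → Pred X ℓ) → (∀ i → Open 𝒮 (U i)) →
    (∀ x → ∃[ i ] x ∈ U i) →
    Σ[ is ∈ List I ] (∀ x → Any (λ i → x ∈ U i) is)

  Compact : Topology S → Set (lsuc ℓ)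
  Compact 𝒮 = Hausdorff 𝒮 × EveryOpenCoverHasFiniteSubcover 𝒮

  ZeroDimensional : Topology S → Set (lsuc ℓ)
  ZeroDimensional 𝒮 = ∀ U → Open 𝒮 U → ∀ x → x ∈ U →
    ∃[ V ] Clopen 𝒮 V × x ∈ V × V ⊆ U

  Discrete : Topology S → Set (lsuc ℓ)
  Discrete 𝒮 = ∀ U → U Respects _≈_ → Open 𝒮 U

Finite : Setoid ℓ ℓ → Set ℓ
Finite S = ∃[ n ] Bijection (≡-setoid (Fin n)) S

record TopologicalSignature ℓ : Set (lsuc (lsuc ℓ)) where
  field
    Op       : ℕ → Setoid ℓ ℓ
    topology : ∀ n → Topology (Op n)

module _ (Ω : TopologicalSignature ℓ) where
  open TopologicalSignature Ω

  record Algebra : Set (lsuc ℓ) where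
    field
      setoid : Setoid ℓ ℓ
      eval   : ∀ n → Func (Op n ×ₛ ≋-setoid setoid n) setoid

    open Setoid setoid public using (_≈_) renaming (Carrier to ∣A∣)

module _ {Ω : TopologicalSignature ℓ} where
  open TopologicalSignature Ω
  open Algebra using (setoid; eval; ∣A∣)

  IsTopologicalAlgebra : (A : Algebra Ω) → Topology (setoid A) → Set (lsuc ℓ)
  IsTopologicalAlgebra A 𝒜 =
    ∀ n → Continuous (topology n ×ᵗ 𝒜 ^ᵗ n) 𝒜 (eval A n)

  IsHomomorphism : (A B : Algebra Ω) → Func (setoid A) (setoid B) → Set ℓ
  IsHomomorphism A B h = ∀ n (ω : Carrier (Op n)) (as : Fin n → ∣A∣ A) →
    (h ⟨$⟩ (eval A n ⟨$⟩ (ω , as))) B.≈ (eval B n ⟨$⟩ (ω , λ i → h ⟨$⟩ as i))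
    where module B = Algebra B

  record FiniteDiscreteAlgebra : Set (lsuc (lsuc ℓ)) where
    field
      algebra       : Algebra Ω
      topologyᴬ     : Topology (setoid algebra)
      isTopological : IsTopologicalAlgebra algebra topologyᴬ
      finite        : Finite (setoid algebra)
      discrete      : Discrete topologyᴬ

  ResiduallyFinite : (A : Algebra Ω) → Topology (setoid A) → Set (lsuc (lsuc ℓ))
  ResiduallyFinite A 𝒜 = ∀ x y → ¬ (x A.≈ y) →
    Σ[ F ∈ FiniteDiscreteAlgebra ]
      let open FiniteDiscreteAlgebra F renaming (algebra to B; topologyᴬ to ℬ)
      in Σ[ h ∈ Func (setoid A) (setoid B) ]
           IsHomomorphism A B h × Continuous 𝒜 ℬ h ×
           ¬ (Algebra._≈_ B (h ⟨$⟩ x) (h ⟨$⟩ y))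
    where module A = Algebra A

  record IsProfinite (A : Algebra Ω) (𝒜 : Topology (setoid A)) : Set (lsuc (lsuc ℓ)) where
    field
      isTopological    : IsTopologicalAlgebra A 𝒜
      compact          : Compact 𝒜
      residuallyFinite : ResiduallyFinite A 𝒜

  record Congruence (A : Algebra Ω) : Set (lsuc ℓ) where
    open Algebra A using (_≈_)
    field
      _∼_           : Rel (∣A∣ A) ℓ
      isEquivalence : IsEquivalence _∼_
      ≈⇒∼           : _≈_ ⇒ _∼_
      compatible    : ∀ n (ω : Carrier (Op n)) (as bs : Fin n → ∣A∣ A) →
                      (∀ i → as i ∼ bs i) →
                      (eval A n ⟨$⟩ (ω , as)) ∼ (eval A n ⟨$⟩ (ω , bs))

    quotientSetoid : Setoid ℓ ℓ
    quotientSetoid = record { isEquivalence = isEquivalence }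

  module _ {A : Algebra Ω} where

    IsClosedCongruence : Topology (setoid A) → Congruence A → Set (lsuc ℓ)
    IsClosedCongruence 𝒜 θ = Closed (𝒜 ×ᵗ 𝒜) (uncurry _∼_)
      where open Congruence θ

    infixl 6 _/ᵗ_

    quotient : (θ : Congruence A) → Algebra Ω
    quotient θ = record
      { setoid = quotientSetoid
      ; eval   = λ n → record
          { to   = eval A n ⟨$⟩_
          ; cong = λ { {_ , as} {_ , bs} (ω≈ω′ , as∼bs) →
              IsEquivalence.trans isEquivalence
                (≈⇒∼ (Func.cong (eval A n) (ω≈ω′ , λ _ → Setoid.refl (setoid A))))
                (compatible n _ as bs as∼bs) }
          }
      }
      where open Congruence θ

    -- The quotient map is the identity on carriers, so preimages under it
    -- are the same predicates.
    _/ᵗ_ : Topology (setoid A) → (θ : Congruence A) → Topology (Congruence.quotientSetoid θ)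
    𝒜 /ᵗ θ = record
      { Open          = λ U → U Respects _∼_ × A.Open U
      ; Open-respects = proj₁
      ; Open-≐        = λ { (U⊆V , V⊆U) (r , o) →
          (λ x∼y v → U⊆V (r x∼y (V⊆U v))) , A.Open-≐ (U⊆V , V⊆U) o }
      ; Open-full     = (λ _ _ → tt) , A.Open-full
      ; Open-∩        = λ { (r , o) (r′ , o′) →
          (λ { x∼y (u , v) → r x∼y u , r′ x∼y v }) , A.Open-∩ o o′ }
      ; Open-⋃        = λ ro →
          (λ { x∼y (i , u) → i , proj₁ (ro i) x∼y u }) , A.Open-⋃ (proj₂ ∘ ro)
      }
      where
      open Congruence θ
      module A = Topology 𝒜

    IsProfiniteCongruence : Topology (setoid A) → Congruence A → Set (lsuc (lsuc ℓ))
    IsProfiniteCongruence 𝒜 θ = IsProfinite (quotient θ) (𝒜 /ᵗ θ)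

{-# OPTIONS --safe #-}
module Submission where

-- Call a congruence open if its classes are open.  In a profinite algebra A
-- the classes of open congruences form a base of the topology, and by
-- compactness every clopen K is a union of classes of a single open
-- congruence κ.  If K is moreover θ-saturated, then it is a union of classes
-- of the join θ ∨ κ, which is again open.  When A/θ is 0-dimensional these
-- joins separate the points of A/θ, and their classes are θ-saturated
-- neighbourhoods small enough to make the operations of A/θ continuous
-- (although A → A/θ need not be an open map).

open import Defs
open import Axiom.ExcludedMiddle using (ExcludedMiddle)
open import Data.Empty using (⊥-elim)
open import Data.Fin.Base using (Fin; zero; suc)
open import Data.List.Base using (List; []; _∷_; lookup; length; deduplicate)
open import Data.List.Membership.Propositional.Properties using (∈-lookup)
open import Data.List.Membership.Setoid.Properties using (∈-deduplicate⁺)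
import Data.List.Relation.Unary.All as All
open import Data.List.Relation.Unary.AllPairs using (_∷_)
open import Data.List.Relation.Unary.Any as Any using (Any; here; there)
open import Data.List.Relation.Unary.Any.Properties using (lookup-index)
open import Data.List.Relation.Unary.Unique.DecSetoid.Properties using (deduplicate-!)
import Data.List.Relation.Unary.Unique.Setoid as UniqueSetoid
open import Data.Product.Base using (Σ-syntax; ∃-syntax; _×_; _,_; proj₁; proj₂)
open import Data.Unit.Polymorphic.Base using (⊤; tt)
import Data.Vec.Base as Vec
open import Data.Vec.Properties using (lookup∘tabulate)
open import Data.Vec.Relation.Binary.Pointwise.Extensional using (Pointwise; ext; ∙⁺⇒⁺∙)
open import Function.Base using (_∘_)
open import Function.Bundles using (Func; _⟨$⟩_)
open import Function.Definitions using (Injective)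
open import Level using (Level) renaming (suc to lsuc)
open import Relation.Binary.Bundles using (Setoid; DecSetoid)
open import Relation.Binary.Core using (Rel; _⇒_)
open import Relation.Binary.Definitions using (_Respects_; Reflexive; Symmetric)
open import Relation.Binary.Construct.Closure.Transitive as Plus using (Plus; [_]; _∼⁺⟨_⟩_)
open import Relation.Binary.PropositionalEquality.Core as ≡ using (_≡_)
open import Relation.Binary.Structures using (IsEquivalence)
open import Relation.Nullary.Decidable.Core using (yes; no)
open import Relation.Nullary.Negation.Core using (¬_)
open import Relation.Unary using (Pred; _∈_; _∉_; _⊆_; ∁)

-- Finiteness of enumerated setoids

module _ {c ℓ : Level} (S : Setoid c ℓ) where
  open Setoid S
  open UniqueSetoid S using (Unique)

  Unique⇒lookup-injective : ∀ {xs} → Unique xs → Injective _≡_ _≈_ (lookup xs)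
  Unique⇒lookup-injective (_  ∷ _) {zero}  {zero}  _  = ≡.refl
  Unique⇒lookup-injective (x≉ ∷ _) {zero}  {suc j} eq =
    ⊥-elim (All.lookup x≉ (∈-lookup j) eq)
  Unique⇒lookup-injective (x≉ ∷ _) {suc i} {zero}  eq =
    ⊥-elim (All.lookup x≉ (∈-lookup i) (sym eq))
  Unique⇒lookup-injective (_  ∷ u) {suc i} {suc j} eq =
    ≡.cong suc (Unique⇒lookup-injective u eq)

module _ {ℓ : Level} (S : DecSetoid ℓ ℓ) where
  open DecSetoid S

  -- Once repetitions are removed, the positions of the list are in bijection with the elements up
  -- to equality.
  enumerated⇒Finite : ∀ xs → (∀ x → Any (x ≈_) xs) → Finite setoid
  enumerated⇒Finite xs enum = length ys , record
    { to        = lookup ys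
    ; cong      = λ { ≡.refl → refl }
    ; bijective = Unique⇒lookup-injective setoid (deduplicate-! S xs)
                , λ x → Any.index (x∈ys x) , λ { ≡.refl → sym (lookup-index (x∈ys x)) }
    }
    where
    ys = deduplicate _≟_ xs
    x∈ys : ∀ x → Any (x ≈_) ys
    x∈ys x = ∈-deduplicate⁺ setoid _≟_ (λ y≈z x≈y → trans x≈y (sym y≈z)) (enum x)

-- Joins, meets and kernels of congruences

Plus-respects : ∀ {a r p} {X : Set a} {R : Rel X r} {P : Pred X p} →
                P Respects R → P Respects (Plus R)
Plus-respects resp [ xRy ]           px = resp xRy px
Plus-respects resp (_ ∼⁺⟨ xy ⟩ yz) px = Plus-respects resp yz (Plus-respects resp xy px)

module _ {ℓ : Level} {Ω : TopologicalSignature ℓ} (A : Algebra Ω) where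
  open Algebra A
  module ≈ = Setoid setoid

  module _ (θ κ : Congruence A) where
    private
      module θ = Congruence θ
      module κ = Congruence κ
      module θ-eq = IsEquivalence θ.isEquivalence
      module κ-eq = IsEquivalence κ.isEquivalence

      -- The composite, unlike the union of θ and κ, is compatible with the operations.
      _⨾_ : Rel ∣A∣ ℓ
      x ⨾ y = ∃[ z ] x θ.∼ z × z κ.∼ y

      ⨾-refl : Reflexive _⨾_
      ⨾-refl = _ , θ-eq.refl , κ-eq.refl

      fromθ : ∀ {x y} → x θ.∼ y → x ⨾ y
      fromθ p = _ , p , κ-eq.refl

      fromκ : ∀ {x y} → x κ.∼ y → x ⨾ y
      fromκ p = _ , θ-eq.refl , p

      ⨾⁺-sym : Symmetric (Plus _⨾_)
      -- The reverse of a `θ`-then-`κ` step runs through `κ` first, so it becomes two composite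
      -- steps, each padded by reflexivity.
      ⨾⁺-sym [ _ , p , q ] = _ ∼⁺⟨ [ fromκ (κ-eq.sym q) ] ⟩ [ fromθ (θ-eq.sym p) ]
      ⨾⁺-sym (_ ∼⁺⟨ p ⟩ q) = _ ∼⁺⟨ ⨾⁺-sym q ⟩ ⨾⁺-sym p

      -- The chains in the coordinates may differ in length. Since `_⨾_` is reflexive, a coordinate
      -- can rest while another moves, so they combine into one chain of steps between whole tuples,
      -- to each of which the operation applies.
      ⨾⁺-compatible : ∀ n ω (as bs : Fin n → ∣A∣) → (∀ i → Plus _⨾_ (as i) (bs i)) →
                      Plus _⨾_ (eval n ⟨$⟩ (ω , as)) (eval n ⟨$⟩ (ω , bs))
      ⨾⁺-compatible n ω as bs as⨾⁺bs =
        -- A tuple agrees with the lookup of its tabulation only pointwise; the outer two links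
        -- bridge this.
        _ ∼⁺⟨ [ fromθ (θ.≈⇒∼ (≈.sym (eval-lookup as))) ] ⟩
        _ ∼⁺⟨ Plus.map step (∙⁺⇒⁺∙ ⨾-refl tabulated) ⟩
        [ fromθ (θ.≈⇒∼ (eval-lookup bs)) ]
        where
        eval-vec : Vec.Vec ∣A∣ n → ∣A∣
        eval-vec v = eval n ⟨$⟩ (ω , Vec.lookup v)

        eval-lookup : ∀ cs → eval-vec (Vec.tabulate cs) ≈ (eval n ⟨$⟩ (ω , cs))
        eval-lookup cs = Func.cong (eval n)
          (Setoid.refl (TopologicalSignature.Op Ω n) , ≈.reflexive ∘ lookup∘tabulate cs)

        tabulated : Pointwise (Plus _⨾_) (Vec.tabulate as) (Vec.tabulate bs)
        tabulated = ext λ i → ≡.subst₂ (Plus _⨾_)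
          (≡.sym (lookup∘tabulate as i)) (≡.sym (lookup∘tabulate bs i)) (as⨾⁺bs i)

        step : ∀ {v w} → Pointwise _⨾_ v w → eval-vec v ⨾ eval-vec w
        step (ext p) = eval n ⟨$⟩ (ω , proj₁ ∘ p)
                     , θ.compatible n ω _ _ (proj₁ ∘ proj₂ ∘ p)
                     , κ.compatible n ω _ _ (proj₂ ∘ proj₂ ∘ p)

    join : Congruence A
    join = record
      { _∼_           = Plus _⨾_
      ; isEquivalence = record
          { refl = [ ⨾-refl ] ; sym = ⨾⁺-sym ; trans = _ ∼⁺⟨_⟩_ }
      ; ≈⇒∼           = λ p → [ fromθ (θ.≈⇒∼ p) ]
      ; compatible    = ⨾⁺-compatible
      }

    join-upperˡ : θ._∼_ ⇒ Congruence._∼_ join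
    join-upperˡ p = [ fromθ p ]

    join-upperʳ : κ._∼_ ⇒ Congruence._∼_ join
    join-upperʳ p = [ fromκ p ]

    join-respects : ∀ {P : Pred ∣A∣ ℓ} → P Respects θ._∼_ → P Respects κ._∼_ →
                    P Respects (Congruence._∼_ join)
    join-respects Pθ Pκ = Plus-respects λ { (_ , p , q) → Pκ q ∘ Pθ p }

  meet : Congruence A → Congruence A → Congruence A
  meet θ κ = record
    { _∼_           = λ x y → x θ.∼ y × x κ.∼ y
    ; isEquivalence = record
        { refl  = θ-eq.refl , κ-eq.refl
        ; sym   = λ (p , q) → θ-eq.sym p , κ-eq.sym q
        ; trans = λ (p , q) (p′ , q′) → θ-eq.trans p p′ , κ-eq.trans q q′
        }
    ; ≈⇒∼           = λ p → θ.≈⇒∼ p , κ.≈⇒∼ p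
    ; compatible    = λ n ω as bs p →
        θ.compatible n ω as bs (proj₁ ∘ p) , κ.compatible n ω as bs (proj₂ ∘ p)
    }
    where
    module θ = Congruence θ
    module κ = Congruence κ
    module θ-eq = IsEquivalence θ.isEquivalence
    module κ-eq = IsEquivalence κ.isEquivalence

  total : Congruence A
  total = record { _∼_ = λ _ _ → ⊤ }

  kernel : (B : Algebra Ω) (h : Func setoid (Algebra.setoid B)) →
           IsHomomorphism A B h → Congruence A
  kernel B h hom = record
    { _∼_           = λ x y → (h ⟨$⟩ x) B.≈ (h ⟨$⟩ y)
    ; isEquivalence = record { refl = B.refl ; sym = B.sym ; trans = B.trans }
    ; ≈⇒∼           = Func.cong h
    ; compatible    = λ n ω as bs p → B.trans (hom n ω as)
        (B.trans (Func.cong (Algebra.eval B n) (Setoid.refl (TopologicalSignature.Op Ω n) , p))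
                 (B.sym (hom n ω bs)))
    }
    where module B = Setoid (Algebra.setoid B)

  -- Open congruences

  module _ (𝒜 : Topology setoid) where
    open Topology 𝒜

    record OpenCongruence : Set (lsuc ℓ) where
      field
        congruence : Congruence A
      open Congruence congruence public
      open IsEquivalence isEquivalence public using (refl; sym; trans)
      field
        class-open : ∀ x → Open (x ∼_)

      -- A saturated set is the union of the classes of its points.
      saturated⇒open : ∀ {P : Pred ∣A∣ ℓ} → P Respects _∼_ → Open P
      saturated⇒open {P} resp = Open-≐
        ((λ { ((x , px) , x∼y) → resp x∼y px }) , λ {y} py → (y , py) , refl)
        (Open-⋃ {I = Σ[ x ∈ ∣A∣ ] P x} (class-open ∘ proj₁))

      coarser-open : ∀ (σ : Congruence A) → _∼_ ⇒ Congruence._∼_ σ → OpenCongruence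
      coarser-open σ ∼⇒σ = record
        { congruence = σ
        ; class-open = λ x → saturated⇒open λ y∼z x∼y → σ-trans x∼y (∼⇒σ y∼z)
        }
        where open IsEquivalence (Congruence.isEquivalence σ) using () renaming (trans to σ-trans)

      class-respects : ∀ (θ : Congruence A) → Congruence._∼_ θ ⇒ _∼_ →
                       ∀ x → (x ∼_) Respects (Congruence._∼_ θ)
      class-respects θ θ⇒∼ x y∼z x∼y = trans x∼y (θ⇒∼ y∼z)

    open OpenCongruence using (congruence) renaming (_∼_ to [_]_∼_)

    total-open : OpenCongruence
    total-open = record { congruence = total ; class-open = λ _ → Open-full }

    ⋀ : ∀ {i} {I : Set i} → (I → OpenCongruence) → List I → OpenCongruence
    ⋀ κ []       = total-open
    ⋀ κ (i ∷ is) = record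
      { congruence = meet (congruence (κ i)) (congruence (⋀ κ is))
      ; class-open = λ x → Open-∩ (OpenCongruence.class-open (κ i) x)
                                  (OpenCongruence.class-open (⋀ κ is) x)
      }

    ⋀-lower : ∀ {i p} {I : Set i} {P : Pred I p} (κ : I → OpenCongruence) {is} → Any P is →
              ∃[ j ] P j × ([ ⋀ κ is ]_∼_ ⇒ [ κ j ]_∼_)
    ⋀-lower κ (here pj)  = _ , pj , proj₁
    ⋀-lower κ (there ps) = let (j , pj , le) = ⋀-lower κ ps in j , pj , le ∘ proj₂

    kernel-open : (F : FiniteDiscreteAlgebra {Ω = Ω}) →
                  let open FiniteDiscreteAlgebra F in
                  (h : Func setoid (Algebra.setoid algebra)) →
                  IsHomomorphism A algebra h → Continuous 𝒜 topologyᴬ h → OpenCongruence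
    kernel-open F h hom cont = record
      { congruence = kernel algebra h hom
      -- The class of `x` is the preimage under `h` of a subset of a discrete space.
      ; class-open = λ x → cont _ (discrete _ λ b≈c hx≈b → B.trans hx≈b b≈c)
      }
      where
      open FiniteDiscreteAlgebra F
      module B = Setoid (Algebra.setoid algebra)

    -- Continuity of eval A at the fixed arguments as suffices: once the signature
    -- variable is close to ω, moving as inside the classes of σ stays in one class of σ.
    quotient-isTopological :
      IsTopologicalAlgebra A 𝒜 → (θ : Congruence A) →
      (∀ V → Topology.Open (𝒜 /ᵗ θ) V → ∀ x → x ∈ V →
        Σ[ σ ∈ OpenCongruence ] (Congruence._∼_ θ ⇒ [ σ ]_∼_) × ([ σ ] x ∼_) ⊆ V) →
      IsTopologicalAlgebra (quotient θ) (𝒜 /ᵗ θ)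
    quotient-isTopological top θ classes n V V-open ω as w =
      let (σ , θ⇒σ , class⊆V) = classes V V-open _ w
          module σ = OpenCongruence σ
          (U , W , U-open , W-open , ω∈U , as∈W , box) = top n _ (σ.class-open _) ω as σ.refl
      in U , (λ bs → ∀ i → as i σ.∼ bs i) , U-open
       , (λ _ bs∈ → (λ i → as i σ.∼_)
                  , (λ i → σ.class-respects θ θ⇒σ (as i) , σ.class-open (as i))
                  , bs∈ , λ _ cs∈ → cs∈)
       , ω∈U , (λ _ → σ.refl)
       , λ ω′ bs ω′∈U as∼bs → class⊆V
           (σ.trans (box ω′ as ω′∈U as∈W) (σ.compatible n ω′ as bs as∼bs))

    -- Open congruences of a profinite algebra

    module _ (em : ExcludedMiddle ℓ) (profinite : IsProfinite A 𝒜) where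
      open IsProfinite profinite

      finiteDiscreteQuotient : OpenCongruence → FiniteDiscreteAlgebra {Ω = Ω}
      finiteDiscreteQuotient σ = record
        { algebra       = quotient σ.congruence
        ; topologyᴬ     = 𝒜 /ᵗ σ.congruence
        ; isTopological = quotient-isTopological isTopological σ.congruence
            -- Open sets of this quotient are `σ`-saturated, so `σ` itself is the required open
            -- congruence.
            λ V (resp , _) x x∈V → σ , (λ p → p) , λ x∼y → resp x∼y x∈V
        ; finite        =
            -- The classes form an open cover, so finitely many of them suffice.
            let (xs , covers) = proj₂ compact ∣A∣ (λ x → x σ.∼_) σ.class-open (λ x → x , σ.refl)
            in enumerated⇒Finite
                 (record { isDecEquivalence = record
                   { isEquivalence = σ.isEquivalence ; _≟_ = λ _ _ → em } })
                 xs (Any.map σ.sym ∘ covers)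
        ; discrete      = λ U resp → resp , σ.saturated⇒open resp
        }
        where module σ = OpenCongruence σ

      -- Compactness leaves finitely many of the sets `V x`, and a finite meet of open congruences
      -- is open. Near a point `z`, the meet is compared with `κ x` for a remaining `x` whose `V x`
      -- contains `z`.
      common-refinement :
        (κ : ∣A∣ → OpenCongruence) (V : ∣A∣ → Pred ∣A∣ ℓ) →
        (∀ x → Open (V x)) → (∀ x → x ∈ V x) →
        Σ[ μ ∈ OpenCongruence ] ∀ z → ∃[ x ] z ∈ V x × ([ μ ]_∼_ ⇒ [ κ x ]_∼_)
      common-refinement κ V V-open x∈Vx =
        let (xs , covers) = proj₂ compact ∣A∣ V V-open (λ x → x , x∈Vx x)
        in ⋀ κ xs , λ z → ⋀-lower κ (covers z)

      separating : ∀ x y → ¬ (x ≈ y) → Σ[ κ ∈ OpenCongruence ] ¬ ([ κ ] x ∼ y)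
      separating x y x≉y =
        let (F , h , hom , cont , hx≉hy) = residuallyFinite x y x≉y
        in kernel-open F h hom cont , hx≉hy

      -- Each `y` outside `U` is separated from `x` by an open congruence, whose class of `y` then
      -- misses the class of `x`. These classes together with `U` cover the space, so a common
      -- refinement keeps the class of `x` inside `U`.
      classes-form-base : ∀ U → Open U → ∀ x → x ∈ U →
                          Σ[ κ ∈ OpenCongruence ] ([ κ ] x ∼_) ⊆ U
      classes-form-base U U-open x x∈U =
        let (μ , refines) = common-refinement (κ ∘ local) (V ∘ local) (V-open ∘ local) (y∈V ∘ local)
        in μ , λ {z} x∼z →
             let (y , z∈V , μ⇒κ) = refines z in inside (local y) z∈V (μ⇒κ x∼z)
        where
        record Local (y : ∣A∣) : Set (lsuc ℓ) where
          field
            κ      : OpenCongruence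
            V      : Pred ∣A∣ ℓ
            V-open : Open V
            y∈V    : y ∈ V
            inside : ∀ {z} → z ∈ V → [ κ ] x ∼ z → z ∈ U
        open Local

        local : ∀ y → Local y
        local y with em {y ∈ U}
        ... | yes y∈U = record
          -- Points of `V` already lie in `U`, so the congruence may be the coarsest one.
          { κ = total-open ; V = U ; V-open = U-open ; y∈V = y∈U
          ; inside = λ z∈U _ → z∈U }
        ... | no y∉U =
          let (κ , x≁y) = separating x y λ x≈y → y∉U (Open-respects U-open x≈y x∈U)
              module κ = OpenCongruence κ
          in record
          { κ = κ ; V = y κ.∼_ ; V-open = κ.class-open y ; y∈V = κ.refl
          ; inside = λ y∼z x∼z → ⊥-elim (x≁y (κ.trans x∼z (κ.sym y∼z))) }

      -- Around each point some class lies wholly in `K` or wholly outside it. Points related by a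
      -- common refinement share one of these classes, so `K` cannot tell them apart.
      clopen-saturated : ∀ K → Clopen K →
                         Σ[ κ ∈ OpenCongruence ] K Respects [ κ ]_∼_
      clopen-saturated K (K-open , ∁K-open) =
        let (μ , refines) = common-refinement κ (λ x → [ κ x ] x ∼_)
                              (λ x → OpenCongruence.class-open (κ x) x)
                              (λ x → OpenCongruence.refl (κ x))
        in μ , λ {z} z∼w z∈K →
             let (x , x∼z , μ⇒κ) = refines z
             in proj₂ (local x) x∼z (OpenCongruence.trans (κ x) x∼z (μ⇒κ z∼w)) z∈K
        where
        local : ∀ x → Σ[ κ ∈ OpenCongruence ]
                        (∀ {z w} → [ κ ] x ∼ z → [ κ ] x ∼ w → z ∈ K → w ∈ K)
        local x with em {x ∈ K}
        ... | yes x∈K = let (κ , class⊆K) = classes-form-base K K-open x x∈K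
                        in κ , λ _ x∼w _ → class⊆K x∼w
        ... | no  x∉K = let (κ , class⊆∁K) = classes-form-base (∁ K) ∁K-open x x∉K
                        in κ , λ x∼z _ z∈K → ⊥-elim (class⊆∁K x∼z z∈K)

        κ : ∣A∣ → OpenCongruence
        κ = proj₁ ∘ local

      -- The join with an open congruence saturating `K` is coarser than that congruence, hence
      -- open, and each link of its chains preserves membership in `K`.
      saturated-clopen : ∀ (θ : Congruence A) K → Clopen K → K Respects (Congruence._∼_ θ) →
        Σ[ σ ∈ OpenCongruence ] (Congruence._∼_ θ ⇒ [ σ ]_∼_) × K Respects [ σ ]_∼_
      saturated-clopen θ K K-clopen Kθ =
        let (κ , Kκ) = clopen-saturated K K-clopen
            θ∨κ = join θ (congruence κ)
        in OpenCongruence.coarser-open κ θ∨κ (join-upperʳ θ (congruence κ))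
         , join-upperˡ θ (congruence κ)
         , join-respects θ (congruence κ) Kθ Kκ

      -- Profiniteness of the quotient

      module _ (θ : Congruence A) (closed : IsClosedCongruence 𝒜 θ)
               (zeroDim : ZeroDimensional (𝒜 /ᵗ θ)) where
        private
          module θ = Congruence θ
          module θ-eq = IsEquivalence θ.isEquivalence
          module A/θ = Topology (𝒜 /ᵗ θ)

        -- When `z` is not related to `y`, an open box around `(z , y)` misses `θ`. The first sides
        -- of these boxes make up the complement of the class of `y`.
        class-closed : ∀ y → A/θ.Open (λ x → ¬ (x θ.∼ y))
        class-closed y =
            (λ x∼x′ x≁y x′∼y → x≁y (θ-eq.trans x∼x′ x′∼y))
          , Open-≐
              ( (λ { {x} ((z , z≁y) , x∈U) →
                   let (_ , _ , _ , _ , _ , y∈V , box) = closed z y z≁y in box x y x∈U y∈V })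
              , λ {x} x≁y → (x , x≁y) , proj₁ (proj₂ (proj₂ (proj₂ (proj₂ (closed x y x≁y))))) )
              (Open-⋃ {I = Σ[ z ∈ ∣A∣ ] ¬ (z θ.∼ y)}
                λ (z , z≁y) → proj₁ (proj₂ (proj₂ (closed z y z≁y))))

        separatingClopen : ∀ x y → ¬ (x θ.∼ y) → ∃[ K ] A/θ.Clopen K × x ∈ K × y ∉ K
        separatingClopen x y x≁y =
          let (K , K-clopen , x∈K , K⊆) = zeroDim _ (class-closed y) x x≁y
          in K , K-clopen , x∈K , λ y∈K → K⊆ y∈K θ-eq.refl

        quotient-isProfinite : IsProfiniteCongruence 𝒜 θ
        quotient-isProfinite = record
          { isTopological = quotient-isTopological isTopological θ λ V V-open x x∈V →
              let (K , ((Kθ , K-open) , (_ , ∁K-open)) , x∈K , K⊆V) = zeroDim V V-open x x∈V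
                  (σ , θ⇒σ , Kσ) = saturated-clopen θ K (K-open , ∁K-open) Kθ
              in σ , θ⇒σ , λ x∼y → K⊆V (Kσ x∼y x∈K)
          ; compact =
              (λ x y x≁y →
                let (K , (K-open , ∁K-open) , x∈K , y∉K) = separatingClopen x y x≁y
                in K , ∁ K , K-open , ∁K-open , x∈K , y∉K , λ _ (z∈K , z∉K) → z∉K z∈K)
            -- An open cover of the quotient is, on the same carrier, an open cover of `A`.
            , λ I U U-open → proj₂ compact I U (proj₂ ∘ U-open)
          ; residuallyFinite = λ x y x≁y →
              let (K , ((Kθ , K-open) , (_ , ∁K-open)) , x∈K , y∉K) = separatingClopen x y x≁y
                  (σ , θ⇒σ , Kσ) = saturated-clopen θ K (K-open , ∁K-open) Kθ
              -- The separating homomorphism is the projection from `A/θ` onto the quotient by `σ`,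
              -- the identity on carriers; it separates `x` from `y` because `K` is `σ`-saturated.
              in finiteDiscreteQuotient σ
               , record { to = λ x → x ; cong = θ⇒σ }
               , (λ _ _ _ → OpenCongruence.refl σ)
               , (λ V (Vσ , V-open) → (λ x∼y → Vσ (θ⇒σ x∼y)) , V-open)
               , λ x∼y → y∉K (Kσ x∼y x∈K)
          }

theorem2p8 : ∀ {ℓ} → ExcludedMiddle ℓ →
    (Ω : TopologicalSignature ℓ)
    (A : Algebra Ω) (𝒜 : Topology (Algebra.setoid A)) →
    IsProfinite A 𝒜 →
    (θ : Congruence A) →
    IsClosedCongruence 𝒜 θ →
    ZeroDimensional (𝒜 /ᵗ θ) →
    IsProfiniteCongruence 𝒜 θ
theorem2p8 em Ω A 𝒜 profinite θ closed zeroDim =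
  quotient-isProfinite A 𝒜 em profinite θ closed zeroDim
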